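{- Let $n,k,\ell$ be positive integers and let $\mathcal{F}\subseteq[n]^{(k)}$ and $\mathcal{G}\subseteq[n]^{(\ell)}$ be cross-intersecting. Then there are sets $M_1\subseteq M_2\subseteq\dots\subseteq M_k\subseteq[n]$ with $\vert M_i\vert\geq n-(k+1-i)\ell$ for each $i\in[k]$ such that one of the following holds: (1) the family $\mathcal{F}(A)$ is pseudo-intersecting for all $i\in[k]$ and all $A\in M_i^{(i)}$; or (2) the family $\mathcal{G}(B)$ is pseudo-intersecting for all $B\subseteq M_2$.
   Context: $[n]=\{1,\dots,n\}$ and $X^{(k)}$ denotes the set of $k$-element subsets of $X$. Families $\mathcal{F},\mathcal{G}$ are cross-intersecting if $F\cap G\neq\emptyset$ for every $F\in\mathcal{F}$, $G\in\mathcal{G}$. The shadow of a family $\mathcal{H}$ of sets is $\partial\mathcal{H}=\{H\setminus\{x\}: x\in H\in\mathcal{H}\}$. For $A,B\subseteq[n]$, $\mathcal{F}(A,\overline{B})=\{F\setminus A: F\in\mathcal{F},\ A\subseteq F,\ B\cap F=\emptyset\}$ and $\mathcal{F}(A)=\mathcal{F}(A,\overline{\emptyset})$ (similarly for $\mathcal{G}$). A family $\mathcal{H}$ of subsets of $[n]$ is pseudo-intersecting if $\vert\partial(\mathcal{H}(\overline{X}))\vert\geq\vert\mathcal{H}(\overline{X})\vert$ for all $X\subseteq[n]$, where $\mathcal{H}(\overline{X})=\{H\in\mathcal{H}: H\cap X=\emptyset\}$.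
   Formalization: When k = 1 the set M_2 in alternative (2) is not defined, since the chain consists of M_1 only; there alternative (2) is read with M_1 in place of M_2 (that is, with M_{min(2,k)}); for k ≥ 2 nothing is changed. -}

module Defs where

open import Data.Bool using (Bool; true; false; _∧_; not; T)
open import Data.Nat using (ℕ; zero; suc; _≤_; _<_; _∸_; _+_; _*_; _⊓_)
open import Data.Fin using (Fin)
open import Relation.Binary.PropositionalEquality using (_≡_)
open import Data.Fin.Subset using (Subset; _∪_; _∩_; ⁅_⁆; _⊆_; ∣_∣; Nonempty)
open import Data.Vec using ([]; _∷_; lookup)
open import Data.List using (List; []; _∷_; map; _++_; length; filterᵇ; allFin)
open import Data.Bool.ListAction using (any; all)

Family : ℕ → Set
Family n = Subset n → Bool

_∈ᶠ_ : ∀ {n} → Subset n → Family n → Set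
S ∈ᶠ H = T (H S)

allSubsets : ∀ n → List (Subset n)
allSubsets zero = [] ∷ []
allSubsets (suc n) = map (false ∷_) (allSubsets n) ++ map (true ∷_) (allSubsets n)

#_ : ∀ {n} → Family n → ℕ
# H = length (filterᵇ H (allSubsets _))

disjointᵇ : ∀ {n} → Subset n → Subset n → Bool
disjointᵇ {n} S X = all (λ x → not (lookup S x ∧ lookup X x)) (allFin n)

-- Shadow ∂H = { H' \ {x} : x ∈ H' ∈ H }:  S ∈ ∂H iff S = H' \ {x} for some
-- H' ∈ H and x ∈ H', i.e. iff there is x ∉ S with S ∪ {x} ∈ H.
∂ : ∀ {n} → Family n → Family n
∂ {n} H S = any (λ x → not (lookup S x) ∧ H (S ∪ ⁅ x ⁆)) (allFin n)

avoid : ∀ {n} → Family n → Subset n → Family n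
avoid H X S = H S ∧ disjointᵇ S X

-- ℋ(A) = { F \ A : A ⊆ F ∈ ℋ } (= ℋ(A, ∅̄)).  The map F ↦ F \ A is a
-- bijection from {F ∈ ℋ : A ⊆ F} onto {S : S ∩ A = ∅, S ∪ A ∈ ℋ}.
link : ∀ {n} → Family n → Subset n → Family n
link H A S = disjointᵇ S A ∧ H (S ∪ A)

Uniform : ∀ {n} → ℕ → Family n → Set
Uniform k H = ∀ S → S ∈ᶠ H → ∣ S ∣ ≡ k

CrossIntersecting : ∀ {n} → Family n → Family n → Set
CrossIntersecting F G = ∀ A B → A ∈ᶠ F → B ∈ᶠ G → Nonempty (A ∩ B)

PseudoIntersecting : ∀ {n} → Family n → Set
PseudoIntersecting H = ∀ X → # (avoid H X) ≤ # (∂ (avoid H X))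

{-# OPTIONS --safe #-}

-- Call a family thin if its shadow is smaller than the family itself. Two thin
-- families contain disjoint members: adjacent shifts keep both families thin and
-- create no disjoint pair, so both may be assumed shifted; a thin family contains
-- a ballot set (every initial segment has at least as many absent as present
-- elements), since otherwise deleting the last unmatched element would inject the
-- family into its shadow; and two ballot sets can be shifted down to disjoint
-- alternating sets.
--
-- A thin family splits over the traces on M of its members, some part of which is
-- thin again. So if 𝒢(B) is not pseudo-intersecting for some B ⊆ M, then, after
-- enlarging B inside M, some thin part of 𝒢(B) avoids M. Put M_{k+1} = [n] and
-- M_i = M_{i+1} \ B_i for such a set B_i ⊆ M_{i+1}, of size at most ℓ. If some
-- ℱ(A) with A ⊆ M_i and |A| = i is not pseudo-intersecting, take i maximal: then a
-- thin part of ℱ(A) avoids M_{i+1}, as does one of 𝒢(B_i), and disjoint members of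
-- these two extend by A and B_i to disjoint members of ℱ and 𝒢.
module Submission where

open import Defs
open import Data.Bool using (Bool; true; false; _∧_; _∨_; not; T; if_then_else_)
open import Data.Bool.ListAction using (and)
open import Data.Bool.Properties using (T-∧; T-∨; T?; T-not-≡; ¬-not)
open import Data.Empty using () renaming (⊥ to Empty)
open import Data.Fin as Fin using (Fin)
open import Data.Fin.Properties using (any?)
open import Data.Fin.Subset using (Subset; _⊆_; ∣_∣; _∪_; ⁅_⁆; ⊤; ⊥; _∈_; _∉_; _─_)
open import Data.Fin.Subset.Properties
  using (∪-identityʳ; ∪-assoc; ∪-comm; anySubset?; s⊆s; x∈p∪q⁻; x∈p∪q⁺; x∈p∩q⁻; x∈⁅x⁆; p⊆p∪q;
         p─q⊆p; ∣q∣≤∣p∪q∣; ∣⊤∣≡n; p⊂q⇒∣p∣<∣q∣; _∈?_; _⊆?_; _⊂?_)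
open import Data.List as List using (length; filterᵇ; map; allFin)
open import Data.List.Membership.Propositional using (lose)
open import Data.List.Membership.Propositional.Properties using (∈-allFin)
open import Data.List.Properties using (filter-++; length-++; map-tabulate)
open import Data.List.Relation.Unary.Any using (satisfied)
open import Data.List.Relation.Unary.Any.Properties using (any⁺; any⁻)
open import Data.Nat
  using (ℕ; zero; suc; _+_; _*_; _∸_; _⊓_; _≤_; _<_; z≤n; s≤s; z<s; ≤′-refl; ≤′-step; _≤′_; _≤?_; _<?_)
open import Data.Nat.Induction using (<-wellFounded)
open import Data.Nat.Properties
open import Data.Nat.Tactic.RingSolver using (solve-∀)
open import Data.Product using (Σ; ∃; ∃₂; _×_; _,_; proj₁; proj₂)
open import Data.Sum using (_⊎_; inj₁; inj₂)
open import Data.Vec using ([]; _∷_; lookup; here; there)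
open import Data.Vec.Properties using ([]=⇒lookup; lookup⇒[]=)
open import Data.Vec.Relation.Binary.Pointwise.Inductive as Pointwise using (Pointwise; []; _∷_)
open import Function using (_∘_; id; case_of_; Equivalence)
open import Induction.WellFounded using (Acc; acc)
open import Relation.Binary.PropositionalEquality
  using (_≡_; refl; sym; trans; cong; cong₂; subst; subst₂; module ≡-Reasoning)
open import Relation.Nullary using (¬_; Dec; yes; no; contradiction)
open import Relation.Nullary.Decidable using (¬?; _×-dec_; decidable-stable)
open Equivalence using (to; from)

private
  variable
    n : ℕ
    F G : Family n

-- Operations on families

_⊑_ : Family n → Family n → Set
F ⊑ G = ∀ S → S ∈ᶠ F → S ∈ᶠ G

_∧ᶠ_ _∨ᶠ_ : Family n → Family n → Family n
(F ∧ᶠ G) S = F S ∧ G S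
(F ∨ᶠ G) S = F S ∨ G S

∁ᶠ : Family n → Family n
∁ᶠ F S = not (F S)

slice : Bool → Family (suc n) → Family n
slice b F S = F (b ∷ S)

∧ᶠ-mono : ∀ {F F′ G G′ : Family n} → F ⊑ F′ → G ⊑ G′ → (F ∧ᶠ G) ⊑ (F′ ∧ᶠ G′)
∧ᶠ-mono p q S t = let (f , g) = to T-∧ t in from T-∧ (p S f , q S g)

-- Sums over all subsets

∑ : (Subset n → ℕ) → ℕ
∑ {zero}  f = f []
∑ {suc n} f = ∑ (f ∘ (false ∷_)) + ∑ (f ∘ (true ∷_))

∑-mono-≤ : {f g : Subset n → ℕ} → (∀ S → f S ≤ g S) → ∑ f ≤ ∑ g
∑-mono-≤ {zero}  f≤g = f≤g []
∑-mono-≤ {suc n} f≤g = +-mono-≤ (∑-mono-≤ (f≤g ∘ (false ∷_))) (∑-mono-≤ (f≤g ∘ (true ∷_)))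

∑-mono-< : {f g : Subset n → ℕ} → (∀ S → f S ≤ g S) → ∀ S → f S < g S → ∑ f < ∑ g
∑-mono-< f≤g []          lt = lt
∑-mono-< f≤g (false ∷ S) lt = +-mono-<-≤ (∑-mono-< (f≤g ∘ (false ∷_)) S lt) (∑-mono-≤ (f≤g ∘ (true ∷_)))
∑-mono-< f≤g (true  ∷ S) lt = +-mono-≤-< (∑-mono-≤ (f≤g ∘ (false ∷_))) (∑-mono-< (f≤g ∘ (true ∷_)) S lt)

∑-cong : {f g : Subset n → ℕ} → (∀ S → f S ≡ g S) → ∑ f ≡ ∑ g
∑-cong f≡g = ≤-antisym (∑-mono-≤ (≤-reflexive ∘ f≡g)) (∑-mono-≤ (≤-reflexive ∘ sym ∘ f≡g))

+-interchange : ∀ a b c d → (a + b) + (c + d) ≡ (a + c) + (b + d)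
+-interchange = solve-∀

∑-distrib-+ : (f g : Subset n → ℕ) → ∑ (λ S → f S + g S) ≡ ∑ f + ∑ g
∑-distrib-+ {zero}  f g = refl
∑-distrib-+ {suc n} f g
  rewrite ∑-distrib-+ (f ∘ (false ∷_)) (g ∘ (false ∷_))
        | ∑-distrib-+ (f ∘ (true ∷_)) (g ∘ (true ∷_))
  = +-interchange (∑ (f ∘ (false ∷_))) (∑ (g ∘ (false ∷_))) (∑ (f ∘ (true ∷_))) (∑ (g ∘ (true ∷_)))

∑-zero : {f : Subset n → ℕ} → (∀ S → f S ≡ 0) → ∑ f ≡ 0
∑-zero {zero}  f≡0 = f≡0 []
∑-zero {suc n} f≡0 = cong₂ _+_ (∑-zero (f≡0 ∘ (false ∷_))) (∑-zero (f≡0 ∘ (true ∷_)))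

⟦_⟧·_ : Bool → ℕ → ℕ
⟦ b ⟧· v = if b then v else 0

length-filterᵇ-map : ∀ {A B : Set} (p : B → Bool) (f : A → B) xs →
  length (filterᵇ p (map f xs)) ≡ length (filterᵇ (p ∘ f) xs)
length-filterᵇ-map p f List.[] = refl
length-filterᵇ-map p f (x List.∷ xs) with p (f x)
... | true  = cong suc (length-filterᵇ-map p f xs)
... | false = length-filterᵇ-map p f xs

#-slices : (F : Family (suc n)) → # F ≡ # (slice false F) + # (slice true F)
#-slices {n} F = begin
  length (filterᵇ F (xs List.++ ys))                ≡⟨ cong length (filter-++ (T? ∘ F) xs ys) ⟩
  length (filterᵇ F xs List.++ filterᵇ F ys)        ≡⟨ length-++ (filterᵇ F xs) ⟩
  length (filterᵇ F xs) + length (filterᵇ F ys)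
    ≡⟨ cong₂ _+_ (length-filterᵇ-map F (false ∷_) (allSubsets n))
                 (length-filterᵇ-map F (true ∷_) (allSubsets n)) ⟩
  # (slice false F) + # (slice true F)              ∎
  where
  open ≡-Reasoning
  xs = map (false ∷_) (allSubsets n)
  ys = map (true ∷_) (allSubsets n)

#≡∑ : (F : Family n) → # F ≡ ∑ (λ S → ⟦ F S ⟧· 1)
#≡∑ {zero} F with F []
... | true  = refl
... | false = refl
#≡∑ {suc n} F = trans (#-slices F) (cong₂ _+_ (#≡∑ (slice false F)) (#≡∑ (slice true F)))

⟦⟧·-mono : ∀ {b c} v → (T b → T c) → ⟦ b ⟧· v ≤ ⟦ c ⟧· v
⟦⟧·-mono {false}         v b⇒c = z≤n
⟦⟧·-mono {true}  {true}  v b⇒c = ≤-refl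
⟦⟧·-mono {true}  {false} v b⇒c with () ← b⇒c _

#-mono : F ⊑ G → # F ≤ # G
#-mono {F = F} {G} F⊑G rewrite #≡∑ F | #≡∑ G = ∑-mono-≤ (λ S → ⟦⟧·-mono 1 (F⊑G S))

#-∧-∁ : (F G : Family n) → # F ≡ # (F ∧ᶠ G) + # (F ∧ᶠ ∁ᶠ G)
#-∧-∁ F G rewrite #≡∑ F | #≡∑ (F ∧ᶠ G) | #≡∑ (F ∧ᶠ ∁ᶠ G) =
  trans (∑-cong pointwise) (∑-distrib-+ (λ S → ⟦ F S ∧ G S ⟧· 1) _)
  where
  pointwise : ∀ S → ⟦ F S ⟧· 1 ≡ ⟦ F S ∧ G S ⟧· 1 + ⟦ F S ∧ not (G S) ⟧· 1
  pointwise S with F S | G S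
  ... | false | _     = refl
  ... | true  | true  = refl
  ... | true  | false = refl

#-∧-∨ : (F G : Family n) → # (F ∧ᶠ G) + # (F ∨ᶠ G) ≡ # F + # G
#-∧-∨ F G rewrite #≡∑ F | #≡∑ G | #≡∑ (F ∧ᶠ G) | #≡∑ (F ∨ᶠ G) =
  trans (sym (∑-distrib-+ (λ S → ⟦ F S ∧ G S ⟧· 1) _))
        (trans (∑-cong pointwise) (∑-distrib-+ (λ S → ⟦ F S ⟧· 1) _))
  where
  pointwise : ∀ S → ⟦ F S ∧ G S ⟧· 1 + ⟦ F S ∨ G S ⟧· 1 ≡ ⟦ F S ⟧· 1 + ⟦ G S ⟧· 1
  pointwise S with F S | G S
  ... | false | _     = refl
  ... | true  | true  = refl
  ... | true  | false = refl

#-positive⇒∃ : (F : Family n) → 0 < # F → ∃ (_∈ᶠ F)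
#-positive⇒∃ {zero} F lt with T? (F [])
... | yes t = [] , t
... | no ¬t = contradiction lt (≤⇒≯ (≤-trans (≤-reflexive (#≡∑ F)) (⟦⟧·-mono {c = false} 1 ¬t)))
#-positive⇒∃ {suc n} F lt with # (slice false F) in eq
... | zero = let S , t = #-positive⇒∃ (slice true F)
                           (subst (0 <_) (trans (#-slices F) (cong (_+ # (slice true F)) eq)) lt)
             in true ∷ S , t
... | suc _ = let S , t = #-positive⇒∃ (slice false F) (subst (0 <_) (sym eq) z<s) in false ∷ S , t

-- Shadows

∂⁻ : (F : Family n) → ∀ {S} → S ∈ᶠ ∂ F → ∃ λ x → lookup S x ≡ false × (S ∪ ⁅ x ⁆) ∈ᶠ F
∂⁻ F t = let x , t′ = satisfied (any⁻ _ (allFin _) t)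
             x∉S , t″ = to T-∧ t′
         in x , to T-not-≡ x∉S , t″

∂⁺ : (F : Family n) → ∀ {S} x → lookup S x ≡ false → (S ∪ ⁅ x ⁆) ∈ᶠ F → S ∈ᶠ ∂ F
∂⁺ F x x∉S t = any⁺ _ (lose (∈-allFin x) (from T-∧ (from T-not-≡ x∉S , t)))

∂-mono : F ⊑ G → ∂ F ⊑ ∂ G
∂-mono {F = F} {G} F⊑G S t = let x , x∉S , t′ = ∂⁻ F t in ∂⁺ G x x∉S (F⊑G _ t′)

-- Deleting the first element moves `slice true` into `slice false`; deleting a later one stays
-- within a slice. These five inclusions are the recursion on which the inductions about shadows
-- run.
∂-true⁻ : (F : Family (suc n)) → slice true (∂ F) ⊑ ∂ (slice true F)
∂-true⁻ F S t with Fin.suc x , x∉S , t′ ← ∂⁻ F t = ∂⁺ (slice true F) x x∉S t′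

∂-true⁺ : (F : Family (suc n)) → ∂ (slice true F) ⊑ slice true (∂ F)
∂-true⁺ F S t = let x , x∉S , t′ = ∂⁻ (slice true F) t in ∂⁺ F (Fin.suc x) x∉S t′

∂-false⁻ : (F : Family (suc n)) → slice false (∂ F) ⊑ (slice true F ∨ᶠ ∂ (slice false F))
∂-false⁻ F S t with ∂⁻ F t
... | Fin.zero  , _   , t′ = from T-∨ (inj₁ (subst (λ R → T (F (true ∷ R))) (∪-identityʳ S) t′))
... | Fin.suc x , x∉S , t′ = from (T-∨ {F (true ∷ S)}) (inj₂ (∂⁺ (slice false F) x x∉S t′))

∂-false⁺ˡ : (F : Family (suc n)) → slice true F ⊑ slice false (∂ F)
∂-false⁺ˡ F S t = ∂⁺ F Fin.zero refl (subst (λ R → T (F (true ∷ R))) (sym (∪-identityʳ S)) t)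

∂-false⁺ʳ : (F : Family (suc n)) → ∂ (slice false F) ⊑ slice false (∂ F)
∂-false⁺ʳ F S t = let x , x∉S , t′ = ∂⁻ (slice false F) t in ∂⁺ F (Fin.suc x) x∉S t′

-- Adjacent shifts

-- The compression that replaces the element after `i` by `i` wherever this gives a new member. The
-- last index acts as the identity, so that indices can range over all of `Fin n`.
shift : Fin n → Family n → Family n
shift {suc zero} Fin.zero F S           = F S
shift Fin.zero    F (false ∷ true ∷ S)  = F (false ∷ true ∷ S) ∧ F (true ∷ false ∷ S)
shift Fin.zero    F (true ∷ false ∷ S)  = F (false ∷ true ∷ S) ∨ F (true ∷ false ∷ S)
shift Fin.zero    F S                   = F S
shift (Fin.suc i) F (b ∷ S)             = shift i (slice b F) S

+-regroup : ∀ a x y d → (a + x) + (y + d) ≡ (a + d) + (x + y)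
+-regroup = solve-∀

#-shift : ∀ i (F : Family n) → # (shift i F) ≡ # F
#-shift {suc zero}    Fin.zero F = refl
#-shift {suc (suc n)} Fin.zero F
  rewrite #-slices F | #-slices (slice false F) | #-slices (slice true F)
        | #-slices (shift Fin.zero F) | #-slices (slice false (shift Fin.zero F))
        | #-slices (slice true (shift Fin.zero F)) =
  trans (+-regroup (# F₀₀) (# (F₀₁ ∧ᶠ F₁₀)) (# (F₀₁ ∨ᶠ F₁₀)) (# F₁₁))
        (trans (cong (# F₀₀ + # F₁₁ +_) (#-∧-∨ F₀₁ F₁₀))
               (sym (+-regroup (# F₀₀) (# F₀₁) (# F₁₀) (# F₁₁))))
  where
  F₀₀ F₀₁ F₁₀ F₁₁ : Family n
  F₀₀ = slice false (slice false F)
  F₀₁ = slice true (slice false F)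
  F₁₀ = slice false (slice true F)
  F₁₁ = slice true (slice true F)
#-shift (Fin.suc i) F
  rewrite #-slices F | #-slices (shift (Fin.suc i) F)
  = cong₂ _+_ (#-shift i (slice false F)) (#-shift i (slice true F))

shift-mono : ∀ i → F ⊑ G → shift i F ⊑ shift i G
shift-mono {suc zero} Fin.zero F⊑G S = F⊑G S
shift-mono {suc (suc n)} Fin.zero F⊑G (false ∷ false ∷ S) = F⊑G _
shift-mono {suc (suc n)} Fin.zero F⊑G (true ∷ true ∷ S) = F⊑G _
shift-mono {suc (suc n)} {F} Fin.zero F⊑G (false ∷ true ∷ S) t =
  let p , q = to T-∧ t in from T-∧ (F⊑G _ p , F⊑G _ q)
shift-mono {suc (suc n)} {F} {G} Fin.zero F⊑G (true ∷ false ∷ S) t with to (T-∨ {F (false ∷ true ∷ S)}) t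
... | inj₁ p = from T-∨ (inj₁ (F⊑G _ p))
... | inj₂ q = from (T-∨ {G (false ∷ true ∷ S)}) (inj₂ (F⊑G _ q))
shift-mono {suc (suc n)} (Fin.suc i) F⊑G (b ∷ S) = shift-mono i (λ R → F⊑G (b ∷ R)) S

∂-∨ : (F G : Family n) → ∂ (F ∨ᶠ G) ⊑ (∂ F ∨ᶠ ∂ G)
∂-∨ F G S t with ∂⁻ (F ∨ᶠ G) t
... | x , x∉S , t′ with to (T-∨ {F (S ∪ ⁅ x ⁆)}) t′
...   | inj₁ p = from T-∨ (inj₁ (∂⁺ F x x∉S p))
...   | inj₂ q = from (T-∨ {∂ F S}) (inj₂ (∂⁺ G x x∉S q))

-- In the slices at the two positions, a shadow of `F₀₁ ∧ᶠ F₁₀` lies in both shadows and a shadow of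
-- `F₀₁ ∨ᶠ F₁₀` in one of them. As shifts preserve size, the shadow of a shifted family is no larger
-- than before.
∂-shift : ∀ i (F : Family n) → ∂ (shift i F) ⊑ shift i (∂ F)
∂-shift {suc zero} Fin.zero F S t = t
∂-shift {suc (suc n)} Fin.zero F = go
  where
  F′ = shift Fin.zero F
  F₀ = slice false F
  F₁ = slice true F
  F₀₁ = slice true F₀
  F₁₀ = slice false F₁
  go : ∂ F′ ⊑ shift Fin.zero (∂ F)
  go (true ∷ true ∷ S) t =
    ∂-true⁺ F (true ∷ S) (∂-true⁺ F₁ S (∂-true⁻ (slice true F′) S (∂-true⁻ F′ (true ∷ S) t)))
  go (true ∷ false ∷ S) t
    with to (T-∨ {F₁ (true ∷ S)}) (∂-false⁻ (slice true F′) S (∂-true⁻ F′ (false ∷ S) t))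
  ... | inj₁ p = from (T-∨ {∂ F (false ∷ true ∷ S)}) (inj₂ (∂-true⁺ F (false ∷ S) (∂-false⁺ˡ F₁ S p)))
  ... | inj₂ q with to (T-∨ {∂ F₀₁ S}) (∂-∨ F₀₁ F₁₀ S q)
  ...   | inj₁ r = from T-∨ (inj₁ (∂-false⁺ʳ F (true ∷ S) (∂-true⁺ F₀ S r)))
  ...   | inj₂ r = from (T-∨ {∂ F (false ∷ true ∷ S)}) (inj₂ (∂-true⁺ F (false ∷ S) (∂-false⁺ʳ F₁ S r)))
  go (false ∷ true ∷ S) t with to (T-∨ {F₁ (true ∷ S)}) (∂-false⁻ F′ (true ∷ S) t)
  ... | inj₁ p = from T-∧ (∂-false⁺ˡ F (true ∷ S) p , ∂-true⁺ F (false ∷ S) (∂-false⁺ˡ F₁ S p))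
  ... | inj₂ q = from T-∧
    ( ∂-false⁺ʳ F (true ∷ S) (∂-true⁺ F₀ S (∂-mono (λ R → proj₁ ∘ to (T-∧ {F₀₁ R} {F₁₀ R})) S r))
    , ∂-true⁺ F (false ∷ S) (∂-false⁺ʳ F₁ S (∂-mono (λ R → proj₂ ∘ to (T-∧ {F₀₁ R} {F₁₀ R})) S r)))
    where
    r : S ∈ᶠ ∂ (F₀₁ ∧ᶠ F₁₀)
    r = ∂-true⁻ (slice false F′) S q
  go (false ∷ false ∷ S) t with to (T-∨ {F₀₁ S ∨ F₁₀ S}) (∂-false⁻ F′ (false ∷ S) t)
  ... | inj₁ p with to (T-∨ {F₀₁ S}) p
  ...   | inj₁ r = ∂-false⁺ʳ F (false ∷ S) (∂-false⁺ˡ F₀ S r)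
  ...   | inj₂ r = ∂-false⁺ˡ F (false ∷ S) r
  go (false ∷ false ∷ S) t | inj₂ q with to (T-∨ {F₀₁ S ∧ F₁₀ S}) (∂-false⁻ (slice false F′) S q)
  ... | inj₁ r = ∂-false⁺ʳ F (false ∷ S) (∂-false⁺ˡ F₀ S (proj₁ (to T-∧ r)))
  ... | inj₂ r = ∂-false⁺ʳ F (false ∷ S) (∂-false⁺ʳ F₀ S r)
∂-shift {suc (suc n)} (Fin.suc i) F (true ∷ S) t =
  shift-mono i (∂-true⁺ F) S (∂-shift i (slice true F) S (∂-true⁻ (shift (Fin.suc i) F) S t))
∂-shift {suc (suc n)} (Fin.suc i) F (false ∷ S) t
  with to (T-∨ {shift i (slice true F) S}) (∂-false⁻ (shift (Fin.suc i) F) S t)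
... | inj₁ p = shift-mono i (∂-false⁺ˡ F) S p
... | inj₂ q = shift-mono i (∂-false⁺ʳ F) S (∂-shift i (slice false F) S q)

_⟂_ : Subset n → Subset n → Set
_⟂_ = Pointwise (λ a b → a ∧ b ≡ false)

DisjointPair : Family n → Family n → Set
DisjointPair F G = ∃₂ λ S R → S ∈ᶠ F × R ∈ᶠ G × S ⟂ R

-- The critical case is 01 against 10. A 01 set left by the shift had both its versions in the
-- original family, and one of them avoids whichever version the other family contained.
unshift-⟂ : ∀ i (F G : Family n) {S R} → S ∈ᶠ shift i F → R ∈ᶠ shift i G → S ⟂ R →
  DisjointPair F G
unshift-⟂ {suc zero} Fin.zero F G f g S⟂R = _ , _ , f , g , S⟂R
unshift-⟂ {suc (suc n)} (Fin.suc i) F G f g (_∷_ {x = a} {y = b} a⟂b S⟂R) =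
  let S′ , R′ , f′ , g′ , d = unshift-⟂ i (slice a F) (slice b G) f g S⟂R
  in a ∷ S′ , b ∷ R′ , f′ , g′ , a⟂b ∷ d
unshift-⟂ {suc (suc n)} Fin.zero F G {a ∷ b ∷ S} {c ∷ d ∷ R} f g (p ∷ q ∷ S⟂R) = go a b c d f g p q
  where
  go : ∀ a b c d → (a ∷ b ∷ S) ∈ᶠ shift Fin.zero F → (c ∷ d ∷ R) ∈ᶠ shift Fin.zero G →
       a ∧ c ≡ false → b ∧ d ≡ false → DisjointPair F G
  go false false false false f g _ _ = _ , _ , f , g , refl ∷ refl ∷ S⟂R
  go false false true  true  f g _ _ = _ , _ , f , g , refl ∷ refl ∷ S⟂R
  go true  true  false false f g _ _ = _ , _ , f , g , refl ∷ refl ∷ S⟂R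
  go false false false true  f g _ _ = _ , _ , f , proj₁ (to T-∧ g) , refl ∷ refl ∷ S⟂R
  go false true  false false f g _ _ = _ , _ , proj₁ (to T-∧ f) , g , refl ∷ refl ∷ S⟂R
  go false false true  false f g _ _ with to (T-∨ {G (false ∷ true ∷ R)}) g
  ... | inj₁ g′ = _ , _ , f , g′ , refl ∷ refl ∷ S⟂R
  ... | inj₂ g′ = _ , _ , f , g′ , refl ∷ refl ∷ S⟂R
  go true  false false false f g _ _ with to (T-∨ {F (false ∷ true ∷ S)}) f
  ... | inj₁ f′ = _ , _ , f′ , g , refl ∷ refl ∷ S⟂R
  ... | inj₂ f′ = _ , _ , f′ , g , refl ∷ refl ∷ S⟂R
  go false true  true  false f g _ _ with to (T-∨ {G (false ∷ true ∷ R)}) g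
  ... | inj₁ g′ = _ , _ , proj₂ (to (T-∧ {F (false ∷ true ∷ S)}) f) , g′ , refl ∷ refl ∷ S⟂R
  ... | inj₂ g′ = _ , _ , proj₁ (to T-∧ f) , g′ , refl ∷ refl ∷ S⟂R
  go true  false false true  f g _ _ with to (T-∨ {F (false ∷ true ∷ S)}) f
  ... | inj₁ f′ = _ , _ , f′ , proj₂ (to (T-∧ {G (false ∷ true ∷ R)}) g) , refl ∷ refl ∷ S⟂R
  ... | inj₂ f′ = _ , _ , f′ , proj₁ (to T-∧ g) , refl ∷ refl ∷ S⟂R

-- Absent elements weigh more the earlier they come, so a shift that changes a
-- family lowers its potential.
height : ℕ → Subset n → ℕ
height         c []          = c
height         c (true  ∷ S) = height c S
height {suc n} c (false ∷ S) = height (c + suc n) S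

height-mono-< : ∀ {c d} → c < d → (S : Subset n) → height c S < height d S
height-mono-< c<d []          = c<d
height-mono-< c<d (true  ∷ S) = height-mono-< c<d S
height-mono-< c<d (false ∷ S) = height-mono-< (+-monoˡ-< _ c<d) S

potential : ℕ → Family n → ℕ
potential c F = ∑ (λ S → ⟦ F S ⟧· height c S)

module _ (c : ℕ) (F : Family (suc (suc n))) where
  private
    p q : Subset n → ℕ
    p = height (c + suc (suc n))
    q = height (c + suc n)
    F₀₁ F₁₀ : Family n
    F₀₁ = slice true (slice false F)
    F₁₀ = slice false (slice true F)
    after before : Subset n → ℕ
    after  S = ⟦ F₀₁ S ∧ F₁₀ S ⟧· p S + ⟦ F₀₁ S ∨ F₁₀ S ⟧· q S
    before S = ⟦ F₀₁ S ⟧· p S + ⟦ F₁₀ S ⟧· q S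

    q<p : ∀ S → q S < p S
    q<p = height-mono-< (+-monoʳ-< c ≤-refl)

    -- The contribution changes only if the 01 set is a member and the 10 set is not; it then drops
    -- from `p S` to `q S`.
    pointwise : ∀ S → after S ≤ before S
    pointwise S with F₀₁ S | F₁₀ S
    ... | false | _     = ≤-refl
    ... | true  | true  = ≤-refl
    ... | true  | false = ≤-trans (<⇒≤ (q<p S)) (m≤m+n _ _)

    outer₀₀ outer₁₁ outer : ℕ
    outer₀₀ = ∑ (λ S → ⟦ F (false ∷ false ∷ S) ⟧· height c (false ∷ false ∷ S))
    outer₁₁ = ∑ (λ S → ⟦ F (true ∷ true ∷ S) ⟧· height c S)
    outer = outer₀₀ + outer₁₁

    split : (f g : Subset n → ℕ) → ∀ a d → (a + ∑ f) + (∑ g + d) ≡ (a + d) + ∑ (λ S → f S + g S)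
    split f g a d = trans (+-regroup a (∑ f) (∑ g) d) (cong (a + d +_) (sym (∑-distrib-+ f g)))

    potential-before : potential c F ≡ outer + ∑ before
    potential-before = split (λ S → ⟦ F₀₁ S ⟧· p S) (λ S → ⟦ F₁₀ S ⟧· q S) outer₀₀ outer₁₁

    potential-after : potential c (shift Fin.zero F) ≡ outer + ∑ after
    potential-after = split (λ S → ⟦ F₀₁ S ∧ F₁₀ S ⟧· p S) (λ S → ⟦ F₀₁ S ∨ F₁₀ S ⟧· q S) outer₀₀ outer₁₁

  potential-shift₀-≤ : potential c (shift Fin.zero F) ≤ potential c F
  potential-shift₀-≤ rewrite potential-before | potential-after = +-monoʳ-≤ outer (∑-mono-≤ pointwise)

  potential-shift₀-< : ∀ S → S ∈ᶠ F → ¬ (S ∈ᶠ shift Fin.zero F) → potential c (shift Fin.zero F) < potential c F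
  potential-shift₀-< (false ∷ false ∷ S) t ¬t = contradiction t ¬t
  potential-shift₀-< (true  ∷ true  ∷ S) t ¬t = contradiction t ¬t
  potential-shift₀-< (true  ∷ false ∷ S) t ¬t = contradiction (from (T-∨ {F₀₁ S}) (inj₂ t)) ¬t
  potential-shift₀-< (false ∷ true  ∷ S) t ¬t =
    subst₂ _<_ (sym potential-after) (sym potential-before)
      (+-monoʳ-< outer (∑-mono-< pointwise S strict))
    where
    strict : after S < before S
    strict with F₀₁ S | F₁₀ S
    ... | true | false = ≤-trans (q<p S) (m≤m+n _ _)
    ... | true | true  = contradiction _ ¬t

potential-shift-≤ : ∀ i c (F : Family n) → potential c (shift i F) ≤ potential c F
potential-shift-≤ {suc zero}    Fin.zero    c F = ≤-refl
potential-shift-≤ {suc (suc n)} Fin.zero    c F = potential-shift₀-≤ c F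
potential-shift-≤ {suc (suc n)} (Fin.suc i) c F =
  +-mono-≤ (potential-shift-≤ i _ (slice false F)) (potential-shift-≤ i c (slice true F))

potential-shift-< : ∀ i c (F : Family n) S → S ∈ᶠ F → ¬ (S ∈ᶠ shift i F) →
  potential c (shift i F) < potential c F
potential-shift-< {suc zero}    Fin.zero    c F S t ¬t = contradiction t ¬t
potential-shift-< {suc (suc n)} Fin.zero    c F S t ¬t = potential-shift₀-< c F S t ¬t
potential-shift-< {suc (suc n)} (Fin.suc i) c F (false ∷ S) t ¬t =
  +-mono-<-≤ (potential-shift-< i _ (slice false F) S t ¬t) (potential-shift-≤ i c (slice true F))
potential-shift-< {suc (suc n)} (Fin.suc i) c F (true ∷ S) t ¬t =
  +-mono-≤-< (potential-shift-≤ i _ (slice false F)) (potential-shift-< i c (slice true F) S t ¬t)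

Thin : Family n → Set
Thin F = # (∂ F) < # F

Thin-shift : ∀ i → Thin F → Thin (shift i F)
Thin-shift {F = F} i thin = begin-strict
  # (∂ (shift i F))  ≤⟨ #-mono (∂-shift i F) ⟩
  # (shift i (∂ F))  ≡⟨ #-shift i (∂ F) ⟩
  # (∂ F)            <⟨ thin ⟩
  # F                ≡⟨ #-shift i F ⟨
  # (shift i F)      ∎
  where open ≤-Reasoning

-- Ballot sequences

-- Read a set as a bracket word, absent elements opening and present ones
-- closing: some closing bracket of S stays unmatched even after d opening
-- brackets have been put in front.
unmatched : ℕ → Family n
unmatched d       []          = false
unmatched d       (false ∷ S) = unmatched (suc d) S
unmatched zero    (true ∷ S)  = true
unmatched (suc d) (true ∷ S)  = unmatched d S

mutual
  -- Deleting the last unmatched element is injective; the inequalities are this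
  -- injection, summed up position by position.
  #-unmatched-suc : ∀ d (F : Family n) → # (F ∧ᶠ unmatched (suc d)) ≤ # (∂ F ∧ᶠ unmatched d)
  #-unmatched-suc {zero}  d F = #-mono {F = F ∧ᶠ unmatched (suc d)} {G = ∂ F ∧ᶠ unmatched d}
    λ { [] t → contradiction (proj₂ (to (T-∧ {F []}) t)) λ () }
  #-unmatched-suc {suc n} d F
    rewrite #-slices (F ∧ᶠ unmatched (suc d)) | #-slices (∂ F ∧ᶠ unmatched d) =
    -- An unmatched closing bracket behind `suc d` opening ones means at least two behind `d`, and
    -- one of these survives the deletion.
    +-mono-≤ (≤-trans (#-unmatched-suc (suc d) F₀)
                      (#-mono (∧ᶠ-mono {G = unmatched (suc d)} (∂-false⁺ʳ F) (λ _ t → t))))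
             (lemma d)
    where
    F₀ = slice false F
    F₁ = slice true F
    lemma : ∀ d → # (F₁ ∧ᶠ unmatched d) ≤ # (slice true (∂ F ∧ᶠ unmatched d))
    -- For `d = 0` the present first element is itself unmatched on the right, so the condition
    -- there is void.
    lemma zero    = ≤-trans (#-unmatched-zero F₁) (#-mono (λ S t → from T-∧ (∂-true⁺ F S t , _)))
    lemma (suc d) = ≤-trans (#-unmatched-suc d F₁) (#-mono (∧ᶠ-mono {G = unmatched d} (∂-true⁺ F) (λ _ t → t)))

  #-unmatched-zero : (F : Family n) → # (F ∧ᶠ unmatched zero) ≤ # (∂ F)
  #-unmatched-zero {zero}  F = #-mono {F = F ∧ᶠ unmatched zero} {G = ∂ F}
    λ { [] t → contradiction (proj₂ (to (T-∧ {F []}) t)) λ () }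
  #-unmatched-zero {suc n} F = begin
    # (F ∧ᶠ u)                                            ≡⟨ #-slices (F ∧ᶠ u) ⟩
    # (F₀ ∧ᶠ unmatched 1) + # (slice true (F ∧ᶠ u))
      ≤⟨ +-monoʳ-≤ (# (F₀ ∧ᶠ unmatched 1)) (#-mono {F = slice true (F ∧ᶠ u)} {G = F₁} (λ S → proj₁ ∘ to T-∧)) ⟩
    # (F₀ ∧ᶠ unmatched 1) + # F₁                          ≡⟨ cong (# (F₀ ∧ᶠ unmatched 1) +_) (#-∧-∁ F₁ u) ⟩
    # (F₀ ∧ᶠ unmatched 1) + (# (F₁ ∧ᶠ u) + # (F₁ ∧ᶠ ∁ᶠ u))
      -- The first element is the one deleted exactly when the rest has nothing unmatched. The rest
      -- stays so, which keeps these images apart from those of `F₀`, whose rest is still unmatched.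
      ≤⟨ +-mono-≤ (≤-trans (#-unmatched-suc 0 F₀) (#-mono (∧ᶠ-mono {G = u} (∂-false⁺ʳ F) (λ _ t → t))))
                  (+-mono-≤ (≤-trans (#-unmatched-zero F₁) (#-mono (∂-true⁺ F)))
                            (#-mono (∧ᶠ-mono {G = ∁ᶠ u} (∂-false⁺ˡ F) (λ _ t → t)))) ⟩
    # (D₀ ∧ᶠ u) + (# D₁ + # (D₀ ∧ᶠ ∁ᶠ u))                 ≡⟨ rearrange (# (D₀ ∧ᶠ u)) (# D₁) _ ⟩
    (# (D₀ ∧ᶠ u) + # (D₀ ∧ᶠ ∁ᶠ u)) + # D₁                 ≡⟨ cong (_+ # D₁) (#-∧-∁ D₀ u) ⟨
    # D₀ + # D₁                                           ≡⟨ #-slices (∂ F) ⟨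
    # (∂ F)                                               ∎
    where
    open ≤-Reasoning
    u : ∀ {m} → Family m
    u = unmatched zero
    F₀ = slice false F
    F₁ = slice true F
    D₀ = slice false (∂ F)
    D₁ = slice true (∂ F)
    rearrange : ∀ a b c → a + (b + c) ≡ (a + c) + b
    rearrange = solve-∀

Thin⇒ballot : (F : Family n) → Thin F → ∃ λ S → S ∈ᶠ F × unmatched 0 S ≡ false
Thin⇒ballot F thin with # (F ∧ᶠ ∁ᶠ (unmatched 0)) in eq
... | suc _ = let S , t = #-positive⇒∃ (F ∧ᶠ ∁ᶠ (unmatched 0)) (subst (0 <_) (sym eq) z<s)
                  t₁ , t₂ = to T-∧ t
              in S , t₁ , to T-not-≡ t₂
... | zero  = contradiction thin (≤⇒≯ (begin
  # F                                                      ≡⟨ #-∧-∁ F (unmatched 0) ⟩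
  # (F ∧ᶠ unmatched 0) + # (F ∧ᶠ ∁ᶠ (unmatched 0))         ≡⟨ cong (# (F ∧ᶠ unmatched 0) +_) eq ⟩
  # (F ∧ᶠ unmatched 0) + 0                                 ≡⟨ +-identityʳ _ ⟩
  # (F ∧ᶠ unmatched 0)                                     ≤⟨ #-unmatched-zero F ⟩
  # (∂ F)                                                  ∎))
  where open ≤-Reasoning

-- Moving ballot sets down to disjoint sets

data _⇝_ : Subset n → Subset n → Set where
  done  : {S : Subset n} → S ⇝ S
  swap  : {S : Subset n} → (false ∷ true ∷ S) ⇝ (true ∷ false ∷ S)
  keep  : ∀ b {S R : Subset n} → S ⇝ R → (b ∷ S) ⇝ (b ∷ R)
  _then_ : {S R Q : Subset n} → S ⇝ R → R ⇝ Q → S ⇝ Q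

-- As shifts preserve size, this is invariance under all of them. The inclusion is the form that
-- gives closure under `_⇝_`: a 01 set survives a shift only beside its 10 partner.
Stable : Family n → Set
Stable F = ∀ i → F ⊑ shift i F

Stable-⇝ : (F : Family n) → Stable F → ∀ {S R} → S ⇝ R → S ∈ᶠ F → R ∈ᶠ F
Stable-⇝ F st done         t = t
Stable-⇝ F st (swap {S = S}) t = proj₂ (to (T-∧ {F (false ∷ true ∷ S)}) (st Fin.zero _ t))
Stable-⇝ {suc (suc n)} F st (keep b r)   t = Stable-⇝ (slice b F) (λ i S → st (Fin.suc i) (b ∷ S)) r t
Stable-⇝ {suc zero} F st (keep b {[]} {[]} r) t = t
Stable-⇝ F st (r then r′)  t = Stable-⇝ F st r′ (Stable-⇝ F st r t)

stable? : (F : Family n) → Stable F ⊎ ∃₂ λ i S → S ∈ᶠ F × ¬ (S ∈ᶠ shift i F)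
stable? F with any? (λ i → anySubset? (λ S → T? (F S) ×-dec ¬? (T? (shift i F S))))
... | yes (i , S , t , ¬t) = inj₂ (i , S , t , ¬t)
... | no ¬p = inj₁ λ i S t → decidable-stable (T? _) λ ¬t → ¬p (i , S , t , ¬t)

-- The first present element moves to the front and uses up one of the `suc d` opening brackets; the
-- absent elements it passes still precede all the others.
ballot-front : ∀ d (S : Subset (suc n)) → unmatched (suc d) S ≡ false →
  S ≡ ⊥ ⊎ ∃ λ R → S ⇝ (true ∷ R) × unmatched d R ≡ false
ballot-front d (true ∷ S)       b = inj₂ (S , done , b)
ballot-front {zero} d (false ∷ []) b = inj₁ refl
ballot-front {suc n} d (false ∷ S) b with ballot-front (suc d) S b
... | inj₁ refl         = inj₁ refl
... | inj₂ (R , r , b′) = inj₂ (false ∷ R , keep false r then swap , b′)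

⊥-⟂ : (S : Subset n) → ⊥ ⟂ S
⊥-⟂ []      = []
⊥-⟂ (b ∷ S) = refl ∷ ⊥-⟂ S

⟂-⊥ : (S : Subset n) → S ⟂ ⊥
⟂-⊥ []          = []
⟂-⊥ (false ∷ S) = refl ∷ ⟂-⊥ S
⟂-⊥ (true  ∷ S) = refl ∷ ⟂-⊥ S

-- Both sets can be moved down to alternating ones, {2,4,…} and {1,3,…}.
ballot-⟂ : ∀ n (S R : Subset n) → unmatched 0 S ≡ false → unmatched 0 R ≡ false →
  ∃₂ λ S′ R′ → S ⇝ S′ × R ⇝ R′ × S′ ⟂ R′
ballot-⟂ zero [] [] _ _ = [] , [] , done , done , []
ballot-⟂ (suc zero) (false ∷ []) (false ∷ []) _ _ = _ , _ , done , done , refl ∷ []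
ballot-⟂ (suc (suc n)) (false ∷ S) (false ∷ R) s r with ballot-front 0 S s | ballot-front 0 R r
... | inj₁ refl | _         = _ , _ , done , done , ⊥-⟂ _
... | inj₂ _    | inj₁ refl = _ , _ , done , done , ⟂-⊥ (false ∷ S)
-- Both sets now start with 01 followed by a ballot set. One more swap turns the second start into
-- 10, and the induction continues on the rests.
... | inj₂ (S₁ , S⇝ , s₁) | inj₂ (R₁ , R⇝ , r₁) =
  let S₂ , R₂ , S₁⇝ , R₁⇝ , d = ballot-⟂ n S₁ R₁ s₁ r₁
  in false ∷ true ∷ S₂ , true ∷ false ∷ R₂
   , keep false (S⇝ then keep true S₁⇝)
   , (keep false R⇝ then (swap then keep true (keep false R₁⇝)))
   , refl ∷ refl ∷ d

Thin⇒⟂ : (F G : Family n) → Thin F → Thin G → DisjointPair F G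
Thin⇒⟂ F G = go F G (<-wellFounded _)
  where
  go : (F G : Family n) → Acc _<_ (potential 0 F + potential 0 G) → Thin F → Thin G → DisjointPair F G
  go F G (acc rec) thinF thinG = cases (stable? F) (stable? G)
    where
    -- Both families are shifted at the same place, even if only one of them changes, so that
    -- `unshift-⟂` applies.
    shifted : ∀ i → potential 0 (shift i F) + potential 0 (shift i G) < potential 0 F + potential 0 G →
              DisjointPair F G
    shifted i lt =
      let S , R , s , r , d = go (shift i F) (shift i G) (rec lt) (Thin-shift i thinF) (Thin-shift i thinG)
      in unshift-⟂ i F G s r d
    cases : Stable F ⊎ (∃₂ λ i S → S ∈ᶠ F × ¬ (S ∈ᶠ shift i F)) →
            Stable G ⊎ (∃₂ λ i S → S ∈ᶠ G × ¬ (S ∈ᶠ shift i G)) → DisjointPair F G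
    cases (inj₂ (i , S , t , ¬t)) _ =
      shifted i (+-mono-<-≤ (potential-shift-< i 0 F S t ¬t) (potential-shift-≤ i 0 G))
    cases (inj₁ _) (inj₂ (i , S , t , ¬t)) =
      shifted i (+-mono-≤-< (potential-shift-≤ i 0 F) (potential-shift-< i 0 G S t ¬t))
    cases (inj₁ stF) (inj₁ stG) =
      let S , s , bS = Thin⇒ballot F thinF
          R , r , bR = Thin⇒ballot G thinG
          S′ , R′ , S⇝ , R⇝ , d = ballot-⟂ _ S R bS bR
      in S′ , R′ , Stable-⇝ F stF S⇝ s , Stable-⇝ G stG R⇝ r , d

-- Disjointness as a Boolean test

disjointᵇ-∷ : ∀ a b (S X : Subset n) → disjointᵇ (a ∷ S) (b ∷ X) ≡ not (a ∧ b) ∧ disjointᵇ S X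
disjointᵇ-∷ a b S X = cong (λ bs → not (a ∧ b) ∧ and bs)
  (trans (map-tabulate Fin.suc meets) (sym (map-tabulate id (meets ∘ Fin.suc))))
  where meets = λ x → not (lookup (a ∷ S) x ∧ lookup (b ∷ X) x)

disjointᵇ⁻ : (S X : Subset n) → T (disjointᵇ S X) → ∀ {x} → x ∈ S → x ∉ X
disjointᵇ⁻ (_ ∷ S) (_ ∷ X) t here here
  with () ← subst T (disjointᵇ-∷ true true S X) t
disjointᵇ⁻ (a ∷ S) (b ∷ X) t (there x∈S) (there x∈X) =
  disjointᵇ⁻ S X (proj₂ (to (T-∧ {not (a ∧ b)}) (subst T (disjointᵇ-∷ a b S X) t))) x∈S x∈X

disjointᵇ⁺ : (S X : Subset n) → (∀ {x} → x ∈ S → x ∉ X) → T (disjointᵇ S X)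
disjointᵇ⁺ [] [] d = _
disjointᵇ⁺ (a ∷ S) (b ∷ X) d = subst T (sym (disjointᵇ-∷ a b S X)) (go a b d)
  where
  go : ∀ a b → (∀ {x} → x ∈ (a ∷ S) → x ∉ (b ∷ X)) → T (not (a ∧ b) ∧ disjointᵇ S X)
  go true  true  d = contradiction here (d here)
  go true  false d = disjointᵇ⁺ S X λ x∈S x∈X → d (there x∈S) (there x∈X)
  go false _     d = disjointᵇ⁺ S X λ x∈S x∈X → d (there x∈S) (there x∈X)

⟂⇒∉ : {S X : Subset n} → S ⟂ X → ∀ {x} → x ∈ S → x ∉ X
⟂⇒∉ {S = S} {X} S⟂X {x} x∈S x∈X
  with () ← trans (sym (cong₂ _∧_ ([]=⇒lookup x∈S) ([]=⇒lookup x∈X))) (Pointwise.lookup S⟂X x)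

-- Fibres

-- For `C ⊆ M`, the sets `S ∪ C` with `S` off `M` are exactly those whose trace on `M` is `C`.
section : (Subset n → ℕ) → Subset n → Subset n → Subset n → ℕ
section f M C S = ⟦ disjointᵇ S M ⟧· f (S ∪ C)

∑-section-true : (f : Subset (suc n) → ℕ) (M C : Subset n) (c : Bool) →
  ∑ (section f (true ∷ M) (c ∷ C)) ≡ ∑ (section (f ∘ (c ∷_)) M C)
∑-section-true f M C c = trans (cong₂ _+_
  (∑-cong λ S → cong (⟦_⟧· f (c ∷ (S ∪ C))) (disjointᵇ-∷ false true S M))
  (∑-zero λ S → cong (⟦_⟧· f (true ∷ (S ∪ C))) (disjointᵇ-∷ true true S M))) (+-identityʳ _)

∑-section-false : (f : Subset (suc n) → ℕ) (M C : Subset n) →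
  ∑ (section f (false ∷ M) (false ∷ C)) ≡ ∑ (section (λ S → f (false ∷ S) + f (true ∷ S)) M C)
∑-section-false f M C = trans
  (cong₂ _+_ (∑-cong λ S → cong (⟦_⟧· f (false ∷ (S ∪ C))) (disjointᵇ-∷ false false S M))
             (∑-cong λ S → cong (⟦_⟧· f (true ∷ (S ∪ C))) (disjointᵇ-∷ true false S M)))
  (trans (sym (∑-distrib-+ (section (f ∘ (false ∷_)) M C) _))
         (∑-cong λ S → distrib (disjointᵇ S M) (f (false ∷ (S ∪ C))) _))
  where
  distrib : ∀ b v w → ⟦ b ⟧· v + ⟦ b ⟧· w ≡ ⟦ b ⟧· (v + w)
  distrib true  v w = refl
  distrib false v w = refl

⊆-inside : ∀ c {C M : Subset n} → C ⊆ M → (c ∷ C) ⊆ (true ∷ M)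
⊆-inside c C⊆M here      = here
⊆-inside c C⊆M (there p) = there (C⊆M p)

-- The sections over all `C ⊆ M` partition both sums, so one of them inherits the strict inequality.
-- Coordinates outside `M` are folded into the summands, which is why arbitrary weights appear; each
-- coordinate inside `M` is fixed to a value that keeps the inequality.
∑-section-< : (f g : Subset n → ℕ) (M : Subset n) → ∑ f < ∑ g →
  ∃ λ C → C ⊆ M × ∑ (section f M C) < ∑ (section g M C)
∑-section-< f g [] lt = [] , id , lt
∑-section-< f g (false ∷ M) lt =
  let C , C⊆M , lt′ = ∑-section-< (λ S → f (false ∷ S) + f (true ∷ S)) (λ S → g (false ∷ S) + g (true ∷ S)) M
                        (subst₂ _<_ (sym (∑-distrib-+ (f ∘ (false ∷_)) _)) (sym (∑-distrib-+ (g ∘ (false ∷_)) _)) lt)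
  in false ∷ C , s⊆s C⊆M , subst₂ _<_ (sym (∑-section-false f M C)) (sym (∑-section-false g M C)) lt′
∑-section-< f g (true ∷ M) lt = lift (choose (∑ (f ∘ (false ∷_)) <? ∑ (g ∘ (false ∷_))))
  where
  choose : Dec (∑ (f ∘ (false ∷_)) < ∑ (g ∘ (false ∷_))) → ∃ λ c → ∑ (f ∘ (c ∷_)) < ∑ (g ∘ (c ∷_))
  choose (yes lt₀) = false , lt₀
  choose (no ≮₀) = true , ≰⇒> λ ≥₁ → <⇒≱ lt (+-mono-≤ (≮⇒≥ ≮₀) ≥₁)
  lift : (∃ λ c → ∑ (f ∘ (c ∷_)) < ∑ (g ∘ (c ∷_))) →
         ∃ λ C → C ⊆ (true ∷ M) × ∑ (section f (true ∷ M) C) < ∑ (section g (true ∷ M) C)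
  lift (c , lt′) =
    let C , C⊆M , lt″ = ∑-section-< (f ∘ (c ∷_)) (g ∘ (c ∷_)) M lt′
    in c ∷ C , ⊆-inside c C⊆M , subst₂ _<_ (sym (∑-section-true f M C c)) (sym (∑-section-true g M C c)) lt″

-- For `C ⊆ M` this is ℋ(A, B̄) with A = `C` and B = `M ─ C`.
trace : Family n → Subset n → Subset n → Family n
trace H M C S = disjointᵇ S M ∧ H (S ∪ C)

#-trace : (H : Family n) (M C : Subset n) → # (trace H M C) ≡ ∑ (section (λ S → ⟦ H S ⟧· 1) M C)
#-trace H M C = trans (#≡∑ (trace H M C)) (∑-cong λ S → lemma (disjointᵇ S M) (H (S ∪ C)))
  where
  lemma : ∀ b c → ⟦ b ∧ c ⟧· 1 ≡ ⟦ b ⟧· (⟦ c ⟧· 1)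
  lemma true  c = refl
  lemma false c = refl

-- An element deleted from a member of the trace lies outside `M`, hence outside `C`, so deleting it
-- commutes with adding `C`.
∂-trace : (H : Family n) {M C : Subset n} → C ⊆ M → ∂ (trace H M C) ⊑ trace (∂ H) M C
∂-trace H {M} {C} C⊆M S t =
  let x , x∉S , t′ = ∂⁻ (trace H M C) t
      disj , t″ = to T-∧ t′
      S+x∌M : ∀ {y} → y ∈ S ∪ ⁅ x ⁆ → y ∉ M
      S+x∌M = disjointᵇ⁻ (S ∪ ⁅ x ⁆) M disj
      x∉C : x ∉ C
      x∉C x∈C = S+x∌M (x∈p∪q⁺ (inj₂ (x∈⁅x⁆ x))) (C⊆M x∈C)
  in from T-∧
    ( disjointᵇ⁺ S M (λ y∈S → S+x∌M (x∈p∪q⁺ (inj₁ y∈S)))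
    , ∂⁺ H x (∉-∪ x x∉S x∉C) (subst (T ∘ H) (exchange S ⁅ x ⁆ C) t″))
  where
  exchange : ∀ (p q r : Subset n) → (p ∪ q) ∪ r ≡ (p ∪ r) ∪ q
  exchange p q r = trans (∪-assoc p q r) (trans (cong (p ∪_) (∪-comm q r)) (sym (∪-assoc p r q)))
  ∉-∪ : ∀ x → lookup S x ≡ false → x ∉ C → lookup (S ∪ C) x ≡ false
  ∉-∪ x x∉S x∉C = ¬-not λ x∈S∪C → case x∈p∪q⁻ S C (lookup⇒[]= x (S ∪ C) x∈S∪C) of λ where
    (inj₁ x∈S) → contradiction (trans (sym ([]=⇒lookup x∈S)) x∉S) λ ()
    (inj₂ x∈C) → x∉C x∈C

-- Thin families lying over a set

-- A failure of pseudo-intersection, in a form that survives restriction: `K` starts as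
-- `avoid (link H A) X` and may shrink while `A` grows.
ThinOver : Family n → Subset n → Set
ThinOver H A = ∃ λ K → Thin K × (∀ S → S ∈ᶠ K → (S ∪ A) ∈ᶠ H)

ThinOff : Family n → Subset n → Subset n → Set
ThinOff H A M = ∃ λ K → Thin K × (∀ S → S ∈ᶠ K → (S ∪ A) ∈ᶠ H × (∀ {x} → x ∈ S → x ∉ M))

ThinOff⇒ThinOver : (H : Family n) (A M : Subset n) → ThinOff H A M → ThinOver H A
ThinOff⇒ThinOver H A M (K , thin , over) = K , thin , λ S t → proj₁ (over S t)

-- On some trace `C` the family `K` outnumbers `∂ K`, and by `∂-trace` that part of `∂ K` contains
-- the shadow of that part of `K`. The trace is then absorbed into `A`.
ThinOver-trace : (H : Family n) (A M : Subset n) → ThinOver H A → ∃ λ C → C ⊆ M × ThinOff H (A ∪ C) M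
ThinOver-trace H A M (K , thin , over)
  with ∑-section-< (λ S → ⟦ ∂ K S ⟧· 1) (λ S → ⟦ K S ⟧· 1) M (subst₂ _<_ (#≡∑ (∂ K)) (#≡∑ K) thin)
... | C , C⊆M , lt = C , C⊆M , trace K M C , thin′ , λ S t →
    let disj , t′ = to T-∧ t in subst (T ∘ H) (regroup S) (over _ t′) , disjointᵇ⁻ S M disj
  where
  thin′ : Thin (trace K M C)
  thin′ = ≤-<-trans (#-mono (∂-trace K C⊆M))
                    (subst₂ _<_ (sym (#-trace (∂ K) M C)) (sym (#-trace K M C)) lt)
  regroup : ∀ S → (S ∪ C) ∪ A ≡ S ∪ (A ∪ C)
  regroup S = trans (∪-assoc S C A) (cong (S ∪_) (∪-comm C A))

¬Pseudo⇒ThinOver : (H : Family n) (A : Subset n) → ¬ PseudoIntersecting (link H A) → ThinOver H A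
¬Pseudo⇒ThinOver H A ¬pseudo with anySubset? (λ X → # (∂ (avoid (link H A) X)) <? # (avoid (link H A) X))
... | yes (X , thin) = avoid (link H A) X , thin , λ S t →
  proj₂ (to (T-∧ {disjointᵇ S A}) (proj₁ (to (T-∧ {link H A S}) t)))
... | no ¬thin       = contradiction (λ X → ≮⇒≥ λ thin → ¬thin (X , thin)) ¬pseudo

pseudo? : (H : Family n) → Dec (PseudoIntersecting H)
pseudo? H with anySubset? (λ X → ¬? (# (avoid H X) ≤? # (∂ (avoid H X))))
... | yes (X , ≰) = no λ pseudo → ≰ (pseudo X)
... | no ¬p       = yes λ X → decidable-stable (_ ≤? _) λ ≰ → ¬p (X , ≰)

-- A thin family is nonempty, so some member of `H` contains `A`.
ThinOver⇒∣∣≤ : ∀ (H : Family n) A {k} → Uniform k H → ThinOver H A → ∣ A ∣ ≤ k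
ThinOver⇒∣∣≤ H A uniform (K , thin , over) =
  let S , t = #-positive⇒∃ K (≤-<-trans z≤n thin)
  in ≤-trans (∣q∣≤∣p∪q∣ S A) (≤-reflexive (uniform (S ∪ A) (over S t)))

x∈p─q⇒x∉q : ∀ {x} (p q : Subset n) → x ∈ p ─ q → x ∉ q
x∈p─q⇒x∉q (_ ∷ p) (true  ∷ q) (there x∈p─q) (there x∈q) = x∈p─q⇒x∉q p q x∈p─q x∈q
x∈p─q⇒x∉q (_ ∷ p) (false ∷ q) (there x∈p─q) (there x∈q) = x∈p─q⇒x∉q p q x∈p─q x∈q

∣p∣∸∣q∣≤∣p─q∣ : (p q : Subset n) → ∣ p ∣ ∸ ∣ q ∣ ≤ ∣ p ─ q ∣
∣p∣∸∣q∣≤∣p─q∣ []          []          = z≤n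
∣p∣∸∣q∣≤∣p─q∣ (true  ∷ p) (true  ∷ q) = ∣p∣∸∣q∣≤∣p─q∣ p q
∣p∣∸∣q∣≤∣p─q∣ (false ∷ p) (true  ∷ q) = ≤-trans (∸-monoʳ-≤ ∣ p ∣ (n≤1+n ∣ q ∣)) (∣p∣∸∣q∣≤∣p─q∣ p q)
∣p∣∸∣q∣≤∣p─q∣ (false ∷ p) (false ∷ q) = ∣p∣∸∣q∣≤∣p─q∣ p q
∣p∣∸∣q∣≤∣p─q∣ (true  ∷ p) (false ∷ q) = ≤-trans suc-∸-≤ (s≤s (∣p∣∸∣q∣≤∣p─q∣ p q))
  where
  suc-∸-≤ : suc ∣ p ∣ ∸ ∣ q ∣ ≤ suc (∣ p ∣ ∸ ∣ q ∣)
  suc-∸-≤ = m≤n+o⇒m∸n≤o (suc ∣ p ∣) ∣ q ∣ (≤-trans (s≤s (m≤n+m∸n ∣ p ∣ ∣ q ∣)) (≤-reflexive (sym (+-suc ∣ q ∣ _))))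

∪-⊆ : {p q r : Subset n} → p ⊆ r → q ⊆ r → p ∪ q ⊆ r
∪-⊆ {p = p} {q} p⊆r q⊆r x∈p∪q with x∈p∪q⁻ p q x∈p∪q
... | inj₁ x∈p = p⊆r x∈p
... | inj₂ x∈q = q⊆r x∈q

⊆∧⊉⇒∣∣< : {p q : Subset n} → p ⊆ q → ¬ (q ⊆ p) → ∣ p ∣ < ∣ q ∣
⊆∧⊉⇒∣∣< {p = p} {q} p⊆q q⊈p with p ⊂? q
... | yes p⊂q = p⊂q⇒∣p∣<∣q∣ p⊂q
... | no p⊄q  = contradiction
  (λ {x} x∈q → decidable-stable (x ∈? p) λ x∉p → p⊄q (p⊆q , x , x∈q , x∉p)) q⊈p

-- `Thin⇒⟂` supplies disjoint members outside `M`; adding the disjoint sets `A` and `B` inside `M`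
-- creates no common element.
CrossIntersecting⇒¬ThinOff : (ℱ 𝒢 : Family n) → CrossIntersecting ℱ 𝒢 → ∀ A B M →
  A ⊆ M → B ⊆ M → (∀ {x} → x ∈ A → x ∉ B) → ThinOff ℱ A M → ThinOff 𝒢 B M → Empty
CrossIntersecting⇒¬ThinOff ℱ 𝒢 cross A B M A⊆M B⊆M A∌B (K , thinK , overK) (L , thinL , overL)
  with S , R , s , r , S⟂R ← Thin⇒⟂ K L thinK thinL
  with S∪A∈ℱ , S∌M ← overK S s | R∪B∈𝒢 , R∌M ← overL R r
  with x , x∈ ← cross (S ∪ A) (R ∪ B) S∪A∈ℱ R∪B∈𝒢
  with x∈S∪A , x∈R∪B ← x∈p∩q⁻ (S ∪ A) (R ∪ B) x∈
  with x∈p∪q⁻ S A x∈S∪A | x∈p∪q⁻ R B x∈R∪B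
... | inj₁ x∈S | inj₁ x∈R = ⟂⇒∉ S⟂R x∈S x∈R
... | inj₁ x∈S | inj₂ x∈B = S∌M x∈S (B⊆M x∈B)
... | inj₂ x∈A | inj₁ x∈R = R∌M x∈R (A⊆M x∈A)
... | inj₂ x∈A | inj₂ x∈B = A∌B x∈A x∈B

-- The descending chain

module Chain {n k ℓ : ℕ} (ℱ 𝒢 : Family n)
         (uniformℱ : Uniform k ℱ) (uniform𝒢 : Uniform ℓ 𝒢) (cross : CrossIntersecting ℱ 𝒢) where

  Bad : Subset n → Set
  Bad M = ∃ λ B → B ⊆ M × ¬ PseudoIntersecting (link 𝒢 B)

  bad? : ∀ M → Dec (Bad M)
  bad? M = anySubset? λ B → B ⊆? M ×-dec ¬? (pseudo? (link 𝒢 B))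

  -- If `M` is not bad, the chain stands still and `obstacle` holds vacuously, so the construction
  -- can proceed for every number of steps.
  record Step (M : Subset n) : Set where
    field
      next     : Subset n
      next⊆    : next ⊆ M
      size     : ∣ M ∣ ∸ ℓ ≤ ∣ next ∣
      obstacle : Bad M → ∃ λ B → B ⊆ M × ThinOff 𝒢 B M × (∀ {x} → x ∈ next → x ∉ B)
  open Step

  step : ∀ M → Step M
  step M = go (bad? M)
    where
    remove : ∀ B → B ⊆ M → ThinOff 𝒢 B M → Step M
    remove B B⊆M thin = record
      { next     = M ─ B
      ; next⊆    = p─q⊆p M B
      -- A thin part of `𝒢` lies over `B`, so `B` is contained in an `ℓ`-set.
      ; size     = ≤-trans (∸-monoʳ-≤ ∣ M ∣ (ThinOver⇒∣∣≤ 𝒢 B uniform𝒢 (ThinOff⇒ThinOver 𝒢 B M thin)))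
                           (∣p∣∸∣q∣≤∣p─q∣ M B)
      ; obstacle = λ _ → B , B⊆M , thin , x∈p─q⇒x∉q M B
      }
    go : Dec (Bad M) → Step M
    go (no ¬bad) = record
      { next = M ; next⊆ = id ; size = m∸n≤m ∣ M ∣ ℓ ; obstacle = λ bad → contradiction bad ¬bad }
    go (yes (B , B⊆M , ¬pseudo)) =
      let C , C⊆M , thin = ThinOver-trace 𝒢 B M (¬Pseudo⇒ThinOver 𝒢 B ¬pseudo)
      in remove (B ∪ C) (∪-⊆ B⊆M C⊆M) thin

  N : ℕ → Subset n
  N zero    = ⊤
  N (suc t) = next (step (N t))

  N-antitone : ∀ {s t} → s ≤ t → N t ⊆ N s
  N-antitone s≤t = go (≤⇒≤′ s≤t)
    where
    go : ∀ {s t} → s ≤′ t → N t ⊆ N s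
    go ≤′-refl                  = id
    go {t = suc t} (≤′-step le) = go le ∘ next⊆ (step (N t))

  N-size : ∀ t → n ∸ t * ℓ ≤ ∣ N t ∣
  N-size zero    = ≤-reflexive (sym (∣⊤∣≡n n))
  N-size (suc t) = begin
    n ∸ (ℓ + t * ℓ)  ≡⟨ cong (n ∸_) (+-comm ℓ (t * ℓ)) ⟩
    n ∸ (t * ℓ + ℓ)  ≡⟨ ∸-+-assoc n (t * ℓ) ℓ ⟨
    n ∸ t * ℓ ∸ ℓ    ≤⟨ ∸-monoˡ-≤ ℓ (N-size t) ⟩
    ∣ N t ∣ ∸ ℓ      ≤⟨ size (step (N t)) ⟩
    ∣ N (suc t) ∣    ∎
    where open ≤-Reasoning

  -- `N` counts removals, so the index is reversed: `M (suc k)` is the whole ground set and `M 1` is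
  -- `N k`.
  M : ℕ → Subset n
  M i = N (k + 1 ∸ i)

  M⊆N : ∀ j → M j ⊆ N (k ∸ j)
  M⊆N j = N-antitone (∸-monoˡ-≤ j (m≤m+n k 1))

  -- It identifies `N (k ∸ j)` with `M (suc j)`, the set that precedes `M j` in the construction.
  k+1∸suc : ∀ j → k + 1 ∸ suc j ≡ k ∸ j
  k+1∸suc j = cong (_∸ suc j) (+-comm k 1)

  module _ (bad : ∀ t → t < k → Bad (N t)) where

    -- Downward induction on j, the number d bounding k ∸ j: after restricting to
    -- the complement of M (suc j), A either stays put or moves up to a larger j.
    ¬ThinOver-ℱ : ∀ d j A → 1 ≤ j → k ≤ j + d → A ⊆ M j → ∣ A ∣ ≡ j → ¬ ThinOver ℱ A
    ¬ThinOver-ℱ d j A 1≤j k≤j+d A⊆M ∣A∣≡j thinA =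
      let C , C⊆N , thin = ThinOver-trace ℱ A (N (k ∸ j)) thinA in cases C C⊆N thin (C ⊆? A)
      where
      cases : ∀ C → C ⊆ N (k ∸ j) → ThinOff ℱ (A ∪ C) (N (k ∸ j)) → Dec (C ⊆ A) → Empty
      -- Now `A ∪ C` has the same elements as `A` and stays inside `M j`, the set `next` of this
      -- step, which misses the obstacle `B`. Since `j` is positive, `k ∸ j < k` and the step is
      -- indeed bad.
      cases C C⊆N thin (yes C⊆A) =
        let B , B⊆N , thinB , ∌B = obstacle (step (N (k ∸ j))) (bad (k ∸ j) (∸-monoʳ-< 1≤j j≤k))
        in CrossIntersecting⇒¬ThinOff ℱ 𝒢 cross (A ∪ C) B (N (k ∸ j)) (M⊆N j ∘ A∪C⊆M) B⊆N
             (λ x∈ → ∌B (subst (λ t → A ∪ C ⊆ N t) k+1∸j≡ A∪C⊆M x∈)) thin thinB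
        where
        j≤k : j ≤ k
        j≤k = subst (_≤ k) ∣A∣≡j (ThinOver⇒∣∣≤ ℱ A uniformℱ thinA)
        A∪C⊆M : A ∪ C ⊆ M j
        A∪C⊆M = ∪-⊆ A⊆M (A⊆M ∘ C⊆A)
        k+1∸j≡ : k + 1 ∸ j ≡ suc (k ∸ j)
        k+1∸j≡ = trans (cong (_∸ j) (+-comm k 1)) (+-∸-assoc 1 j≤k)
      cases C C⊆N thin (no C⊈A) = climb d k≤j+d
        where
        j′ = ∣ A ∪ C ∣
        thinA∪C : ThinOver ℱ (A ∪ C)
        thinA∪C = ThinOff⇒ThinOver ℱ (A ∪ C) (N (k ∸ j)) thin
        j<j′ : j < j′
        j<j′ = subst (_< j′) ∣A∣≡j (⊆∧⊉⇒∣∣< (p⊆p∪q C) (λ ∪⊆A → C⊈A λ x∈C → ∪⊆A (x∈p∪q⁺ (inj₂ x∈C))))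
        -- Both parts lie in `M (suc j)`, which is contained in `M j′` because `j < j′`.
        A∪C⊆M : A ∪ C ⊆ M j′
        A∪C⊆M x∈ = N-antitone (≤-trans (∸-monoʳ-≤ (k + 1) j<j′) (≤-reflexive (k+1∸suc j)))
                     (∪-⊆ (λ x∈A → M⊆N j (A⊆M x∈A)) C⊆N x∈)
        climb : ∀ d → k ≤ j + d → Empty
        -- Here `k ≤ j < j′`, whereas a set with a thin part of `ℱ` over it has at most `k`
        -- elements.
        climb zero k≤j = <⇒≱ (<-≤-trans j<j′ (ThinOver⇒∣∣≤ ℱ (A ∪ C) uniformℱ thinA∪C))
                             (subst (k ≤_) (+-identityʳ j) k≤j)
        climb (suc d) k≤j+1+d = ¬ThinOver-ℱ d j′ (A ∪ C) (≤-trans 1≤j (<⇒≤ j<j′))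
          (≤-trans k≤j+1+d (≤-trans (≤-reflexive (+-suc j d)) (+-monoˡ-≤ d j<j′)))
          A∪C⊆M refl thinA∪C

  M-suc : ∀ i → M i ⊆ M (suc i)
  M-suc i = N-antitone (∸-monoʳ-≤ (k + 1) (n≤1+n i))

  -- A bad set inside `M (2 ⊓ k)` also lies in every `N t` with `t < k`, so every step leading to
  -- one of `M 1`, ..., `M k` has an obstacle and no `ℱ(A)` can fail.
  alternatives :
    (∀ i → 1 ≤ i → i ≤ k → (A : Subset n) → A ⊆ M i → ∣ A ∣ ≡ i → PseudoIntersecting (link ℱ A))
    ⊎ (∀ (B : Subset n) → B ⊆ M (2 ⊓ k) → PseudoIntersecting (link 𝒢 B))
  alternatives with bad? (M (2 ⊓ k))
  ... | no ¬bad = inj₂ λ B B⊆M → decidable-stable (pseudo? (link 𝒢 B)) λ ¬pseudo → ¬bad (B , B⊆M , ¬pseudo)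
  ... | yes (B , B⊆M , ¬pseudoB) = inj₁ λ i 1≤i i≤k A A⊆M ∣A∣≡i →
    decidable-stable (pseudo? (link ℱ A)) λ ¬pseudo →
      ¬ThinOver-ℱ bad k i A 1≤i (m≤n+m k i) A⊆M ∣A∣≡i (¬Pseudo⇒ThinOver ℱ A ¬pseudo)
    where
    bad : ∀ t → t < k → Bad (N t)
    bad t t<k = B , N-antitone t≤ ∘ B⊆M , ¬pseudoB
      where
      -- The last index below `k` is `k ∸ 1`, which belongs to `M 2`; for `k = 1` the minimum
      -- selects the smaller set `M 1`.
      t≤ : t ≤ k + 1 ∸ (2 ⊓ k)
      t≤ = begin
        t                ≤⟨ ∸-monoˡ-≤ 1 t<k ⟩
        k ∸ 1            ≡⟨ k+1∸suc 1 ⟨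
        k + 1 ∸ 2        ≤⟨ ∸-monoʳ-≤ (k + 1) (m⊓n≤m 2 k) ⟩
        k + 1 ∸ (2 ⊓ k)  ∎
        where open ≤-Reasoning

theorem1p7 : (n k ℓ : ℕ) → 1 ≤ n → 1 ≤ k → 1 ≤ ℓ →
  (ℱ 𝒢 : Family n) → Uniform k ℱ → Uniform ℓ 𝒢 → CrossIntersecting ℱ 𝒢 →
  Σ (ℕ → Subset n) λ M →
    (∀ i → 1 ≤ i → i < k → M i ⊆ M (suc i)) ×
    (∀ i → 1 ≤ i → i ≤ k → n ∸ (k + 1 ∸ i) * ℓ ≤ ∣ M i ∣) ×
    ((∀ i → 1 ≤ i → i ≤ k → (A : Subset n) → A ⊆ M i → ∣ A ∣ ≡ i →
        PseudoIntersecting (link ℱ A))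
     ⊎ (∀ (B : Subset n) → B ⊆ M (2 ⊓ k) → PseudoIntersecting (link 𝒢 B)))
theorem1p7 n k ℓ _ _ _ ℱ 𝒢 uniformℱ uniform𝒢 cross =
  M , (λ i _ _ → M-suc i) , (λ i _ _ → N-size (k + 1 ∸ i)) , alternatives
  where open Chain ℱ 𝒢 uniformℱ uniform𝒢 cross
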